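{- Let $G$ be a connected graph on $n\ge 2$ vertices. Then $$\frac{2}{n-1}\le \gamma(G)\le \frac{n}{n-1}.$$ Equality holds in the lower bound if and only if $G$ is isomorphic to the path $P_n$, and equality holds in the upper bound if and only if $G$ is isomorphic to the complete graph $K_n$.
   Context: For a finite simple undirected graph $G$ with $n$ vertices, let $\mathcal{F}=\{x\in\mathbb{R}^{V(G)} : \sum_{v} x_v = 0,\ \|x\|_\infty = 1\}$, for $x\in\mathcal{F}$ let $\gamma_x(G)=\max_{uv\in E(G)}|x_u-x_v|$, and $\gamma(G)=\min_{x\in\mathcal{F}}\gamma_x(G)$. -}

module Defs where

open import Data.Bool using (if_then_else_)
open import Data.Fin using (Fin; toℕ)
import Data.Fin.Properties as Fin
open import Data.Nat as ℕ using (ℕ; suc; _∸_; NonZero; NonTrivial)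
import Data.Nat.Properties as ℕ
open import Data.Product using (∃; _×_; _,_)
open import Data.Rational as ℚ using (ℚ; 0ℚ; 1ℚ; ½)
import Data.Rational.Properties as ℚ
open import Data.Rational.Solver using (module +-*-Solver)
open import Data.Sum using (_⊎_; inj₁; inj₂; [_,_]′; swap)
open import Data.Vec.Functional using (Vector; foldr)
open import Function using (_↔_; _⇔_; Inverse)
open import Level using (0ℓ)
open import Relation.Binary using (Rel; Symmetric; Irreflexive; Decidable)
open import Relation.Binary.Construct.Closure.ReflexiveTransitive using (Star)
open import Relation.Binary.PropositionalEquality
  using (_≡_; _≢_; refl; sym; trans; cong; subst; ≢-sym; module ≡-Reasoning)
open import Relation.Nullary using (does; ¬?; _⊎-dec_)

-- Real numbers are Cauchy sequences of rationals, compared with the setoid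
-- equality _≃_ (limits agree) rather than _≡_.

IsCauchy : (ℕ → ℚ) → Set
IsCauchy s = ∀ ε → 0ℚ ℚ.< ε →
  ∃ λ N → ∀ i j → N ℕ.≤ i → N ℕ.≤ j → ℚ.∣ s i ℚ.- s j ∣ ℚ.< ε

record ℝ : Set where
  constructor mkℝ
  field
    seq    : ℕ → ℚ
    cauchy : IsCauchy seq

open ℝ public

private
  neg-sub : ∀ p q → ℚ.- (p ℚ.- q) ≡ q ℚ.- p
  neg-sub = solve 2 (λ p q → :- (p :- q) := q :- p) refl
    where open +-*-Solver

  p≤∣p∣ : ∀ p → p ℚ.≤ ℚ.∣ p ∣
  p≤∣p∣ p = [ (λ 0≤p → ℚ.≤-reflexive (sym (ℚ.0≤p⇒∣p∣≡p 0≤p)))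
            , (λ p≤0 → ℚ.≤-trans p≤0 (ℚ.nonNegative⁻¹ ℚ.∣ p ∣ {{ℚ.∣-∣-nonNeg p}}))
            ]′ (ℚ.≤-total 0ℚ p)

  ∣-∣< : ∀ p q {ε} → p ℚ.- q ℚ.< ε → q ℚ.- p ℚ.< ε → ℚ.∣ p ℚ.- q ∣ ℚ.< ε
  ∣-∣< p q h k = [ (λ e → ℚ.≤-<-trans (ℚ.≤-reflexive e) h)
                 , (λ e → ℚ.≤-<-trans (ℚ.≤-reflexive (trans e (neg-sub p q))) k)
                 ]′ (ℚ.∣p∣≡p∨∣p∣≡-p (p ℚ.- q))

  ∣-∣<⇒< : ∀ p q {ε} → ℚ.∣ p ℚ.- q ∣ ℚ.< ε → p ℚ.- q ℚ.< ε
  ∣-∣<⇒< p q = ℚ.≤-<-trans (p≤∣p∣ (p ℚ.- q))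

  ∣neg∣ : ∀ p q → ℚ.∣ ℚ.- p ℚ.- ℚ.- q ∣ ≡ ℚ.∣ p ℚ.- q ∣
  ∣neg∣ p q = trans (cong ℚ.∣_∣ (sym (ℚ.neg-distrib-+ p (ℚ.- q)))) (ℚ.∣-p∣≡∣p∣ (p ℚ.- q))

  +-interchange : ∀ a b c d →
    (a ℚ.+ b) ℚ.- (c ℚ.+ d) ≡ (a ℚ.- c) ℚ.+ (b ℚ.- d)
  +-interchange = solve 4 (λ a b c d → (a :+ b) :- (c :+ d) := (a :- c) :+ (b :- d)) refl
    where open +-*-Solver

  halves : ∀ ε → ½ ℚ.* ε ℚ.+ ½ ℚ.* ε ≡ ε
  halves ε = begin
    ½ ℚ.* ε ℚ.+ ½ ℚ.* ε ≡⟨ ℚ.*-distribʳ-+ ε ½ ½ ⟨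
    1ℚ ℚ.* ε            ≡⟨ ℚ.*-identityˡ ε ⟩
    ε                   ∎
    where open ≡-Reasoning

  half-pos : ∀ ε → 0ℚ ℚ.< ε → 0ℚ ℚ.< ½ ℚ.* ε
  half-pos ε 0<ε = subst (ℚ._< ½ ℚ.* ε) (ℚ.*-zeroʳ ½) (ℚ.*-monoʳ-<-pos ½ 0<ε)

  ⊔-sub< : ∀ a b c d {ε} → a ℚ.- c ℚ.< ε → b ℚ.- d ℚ.< ε →
           (a ℚ.⊔ b) ℚ.- (c ℚ.⊔ d) ℚ.< ε
  ⊔-sub< a b c d h k =
    [ (λ e → ℚ.≤-<-trans (ℚ.+-mono-≤ (ℚ.≤-reflexive e) (ℚ.neg-antimono-≤ (ℚ.p≤p⊔q c d))) h)
    , (λ e → ℚ.≤-<-trans (ℚ.+-mono-≤ (ℚ.≤-reflexive e) (ℚ.neg-antimono-≤ (ℚ.p≤q⊔p c d))) k)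
    ]′ (ℚ.⊔-sel a b)

fromℚ : ℚ → ℝ
fromℚ q .seq _ = q
fromℚ q .cauchy ε 0<ε = 0 , λ _ _ _ _ →
  subst (λ r → ℚ.∣ r ∣ ℚ.< ε) (sym (ℚ.+-inverseʳ q)) 0<ε

0ℝ 1ℝ : ℝ
0ℝ = fromℚ 0ℚ
1ℝ = fromℚ 1ℚ

infix  8 -_
infixl 6 _+_ _-_ _⊔_
infix  4 _≃_ _≤_

_+_ : ℝ → ℝ → ℝ
(x + y) .seq i = seq x i ℚ.+ seq y i
(x + y) .cauchy ε 0<ε
  with M , f ← cauchy x (½ ℚ.* ε) (half-pos ε 0<ε)
  with N , g ← cauchy y (½ ℚ.* ε) (half-pos ε 0<ε)
  = M ℕ.⊔ N , λ i j le le′ → begin-strict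
    ℚ.∣ (seq x i ℚ.+ seq y i) ℚ.- (seq x j ℚ.+ seq y j) ∣
      ≡⟨ cong ℚ.∣_∣ (+-interchange (seq x i) (seq y i) (seq x j) (seq y j)) ⟩
    ℚ.∣ (seq x i ℚ.- seq x j) ℚ.+ (seq y i ℚ.- seq y j) ∣
      ≤⟨ ℚ.∣p+q∣≤∣p∣+∣q∣ (seq x i ℚ.- seq x j) (seq y i ℚ.- seq y j) ⟩
    ℚ.∣ seq x i ℚ.- seq x j ∣ ℚ.+ ℚ.∣ seq y i ℚ.- seq y j ∣
      <⟨ ℚ.+-mono-< (f i j (ℕ.m⊔n≤o⇒m≤o M N le) (ℕ.m⊔n≤o⇒m≤o M N le′))
                    (g i j (ℕ.m⊔n≤o⇒n≤o M N le) (ℕ.m⊔n≤o⇒n≤o M N le′)) ⟩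
    ½ ℚ.* ε ℚ.+ ½ ℚ.* ε
      ≡⟨ halves ε ⟩
    ε ∎
  where open ℚ.≤-Reasoning

-_ : ℝ → ℝ
(- x) .seq i = ℚ.- seq x i
(- x) .cauchy ε 0<ε with N , f ← cauchy x ε 0<ε = N , λ i j le le′ →
  ℚ.≤-<-trans (ℚ.≤-reflexive (∣neg∣ (seq x i) (seq x j))) (f i j le le′)

_-_ : ℝ → ℝ → ℝ
x - y = x + (- y)

_⊔_ : ℝ → ℝ → ℝ
(x ⊔ y) .seq i = seq x i ℚ.⊔ seq y i
(x ⊔ y) .cauchy ε 0<ε
  with M , f ← cauchy x ε 0<ε
  with N , g ← cauchy y ε 0<ε
  = M ℕ.⊔ N , λ i j le le′ →
    let f′ : ∀ i j → M ℕ.⊔ N ℕ.≤ i → M ℕ.⊔ N ℕ.≤ j → seq x i ℚ.- seq x j ℚ.< ε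
        f′ i j le le′ = ∣-∣<⇒< (seq x i) (seq x j)
          (f i j (ℕ.m⊔n≤o⇒m≤o M N le) (ℕ.m⊔n≤o⇒m≤o M N le′))
        g′ : ∀ i j → M ℕ.⊔ N ℕ.≤ i → M ℕ.⊔ N ℕ.≤ j → seq y i ℚ.- seq y j ℚ.< ε
        g′ i j le le′ = ∣-∣<⇒< (seq y i) (seq y j)
          (g i j (ℕ.m⊔n≤o⇒n≤o M N le) (ℕ.m⊔n≤o⇒n≤o M N le′))
    in ∣-∣< (seq x i ℚ.⊔ seq y i) (seq x j ℚ.⊔ seq y j)
         (⊔-sub< (seq x i) (seq y i) (seq x j) (seq y j) (f′ i j le le′) (g′ i j le le′))
         (⊔-sub< (seq x j) (seq y j) (seq x i) (seq y i) (f′ j i le′ le) (g′ j i le′ le))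

∣_∣ : ℝ → ℝ
∣ x ∣ = x ⊔ (- x)

_≃_ : Rel ℝ 0ℓ
x ≃ y = ∀ ε → 0ℚ ℚ.< ε →
  ∃ λ N → ∀ i → N ℕ.≤ i → ℚ.∣ seq x i ℚ.- seq y i ∣ ℚ.< ε

-- The non-strict order of the limits: the slack ε is needed because x ≤ y
-- does not imply that the approximants are eventually ordered.
_≤_ : Rel ℝ 0ℓ
x ≤ y = ∀ ε → 0ℚ ℚ.< ε →
  ∃ λ N → ∀ i → N ℕ.≤ i → seq x i ℚ.- seq y i ℚ.< ε

record Graph (n : ℕ) : Set₁ where
  field
    Adj    : Rel (Fin n) 0ℓ
    symm   : Symmetric Adj
    irrefl : Irreflexive _≡_ Adj
    adj?   : Decidable Adj

open Graph public

Connected : ∀ {n} → Graph n → Set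
Connected G = ∀ u v → Star (Adj G) u v

record _≅_ {m n} (G : Graph m) (H : Graph n) : Set where
  field
    bijection : Fin m ↔ Fin n
    preserves : ∀ u v → Adj G u v ⇔ Adj H (Inverse.to bijection u) (Inverse.to bijection v)

infix 4 _≅_

path : ∀ n → Graph n
path n = record
  { Adj    = λ u v → toℕ v ≡ suc (toℕ u) ⊎ toℕ u ≡ suc (toℕ v)
  ; symm   = swap
  ; irrefl = λ { refl (inj₁ e) → ℕ.1+n≢n (sym e) ; refl (inj₂ e) → ℕ.1+n≢n (sym e) }
  ; adj?   = λ u v → (toℕ v ℕ.≟ suc (toℕ u)) ⊎-dec (toℕ u ℕ.≟ suc (toℕ v))
  }

complete : ∀ n → Graph n
complete n = record
  { Adj    = _≢_
  ; symm   = ≢-sym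
  ; irrefl = λ u≡v u≢v → u≢v u≡v
  ; adj?   = λ u v → ¬? (u Fin.≟ v)
  }

∑ : ∀ {n} → Vector ℝ n → ℝ
∑ = foldr _+_ 0ℝ

-- Only used on families of non-negative reals, so that starting from 0
-- does not affect the maximum of a non-empty family.
⨆ : ∀ {n} → Vector ℝ n → ℝ
⨆ = foldr _⊔_ 0ℝ

‖_‖∞ : ∀ {n} → Vector ℝ n → ℝ
‖ x ‖∞ = ⨆ λ v → ∣ x v ∣

𝓕 : ∀ n → Vector ℝ n → Set
𝓕 n x = ∑ x ≃ 0ℝ × ‖ x ‖∞ ≃ 1ℝ

-- Non-adjacent pairs contribute 0, which is harmless as soon as G has an edge;
-- on an edgeless graph this fixes the convention max ∅ = 0.
γₓ : ∀ {n} → Graph n → Vector ℝ n → ℝ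
γₓ G x = ⨆ λ u → ⨆ λ v → if does (adj? G u v) then ∣ x u - x v ∣ else 0ℝ

-- γ is the (attained) minimum of γₓ G over 𝓕; it is unique up to _≃_.
IsGamma : ∀ {n} → Graph n → ℝ → Set
IsGamma {n} G γ =
  (∃ λ x → 𝓕 n x × γₓ G x ≃ γ) × (∀ x → 𝓕 n x → γ ≤ γₓ G x)

instance
  n∸1-nonZero : ∀ {n} → .{{NonTrivial n}} → NonZero (n ∸ 1)
  n∸1-nonZero {suc (suc _)} = _

{-# OPTIONS --safe #-}
module Submission where

-- Let D be the maximum over v of the transmission σ(v) = Σᵤ d(u,v).  Then γ(G) = n / D.
-- Lower bound: if g is the largest jump of x along an edge, then |x_v - x_u| ≤ g d(u,v),
-- and summing over u gives n |x_v| ≤ g σ(v) + |Σ x| ≤ g D + |Σ x|.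
-- Attainment: for c with σ(c) = D take x_u = 1 - (n / D) d(u,c); here x_u ≥ -1 because
-- n d(u,c) ≤ σ(u) + σ(c) ≤ 2 D by the triangle inequality.
-- The bounds are then n - 1 ≤ D ≤ n (n - 1) / 2: every other vertex is at distance ≥ 1, and
-- the distances from v leave no gaps, so at the extreme they are 0, 1, …, n - 1 and G is a path.

open import Defs
open import Data.Integer using (+_)
open import Data.Nat using (ℕ; _∸_; NonTrivial)
open import Data.Product using (∃; _×_)
open import Data.Rational using (_/_)
open import Function using (_⇔_)

open import Algebra.Bundles using (CommutativeRing)
import Algebra.Properties.Semiring.Sum
open import Data.Bool using (if_then_else_)
open import Data.Fin using (Fin; zero; suc; toℕ; fromℕ<; punchIn; punchOut)
import Data.Fin.Properties as Fin
import Data.Integer as ℤ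
import Data.Integer.Properties as ℤ
open import Data.Nat as ℕ using (zero; suc; z≤n; s≤s; NonZero)
import Data.Nat.Properties as ℕ
open import Data.Nat.Tactic.RingSolver using (solve-∀)
open import Data.Product using (_,_; proj₁; proj₂)
open import Data.Rational as ℚ using (ℚ; 0ℚ; 1ℚ; toℚᵘ; fromℚᵘ)
import Data.Rational.Properties as ℚ
open import Data.Rational.Solver using (module +-*-Solver)
open import Data.Rational.Unnormalised as ℚᵘ using (mkℚᵘ)
import Data.Rational.Unnormalised.Properties as ℚᵘ
open import Data.Sum using (_⊎_; inj₁; inj₂)
open import Data.Vec.Functional using (Vector)
open import Function using (_∘_; Injective; mk↔ₛ′; mk⇔; Inverse; Equivalence; Injection)
open import Function.Properties.Inverse using (↔⇒↣)
open import Level using (0ℓ)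
open import Relation.Binary.Construct.Closure.ReflexiveTransitive using (Star; _◅_)
open import Relation.Binary.PropositionalEquality
open import Relation.Nullary using (yes; no; does; _×-dec_; contradiction)
open import Relation.Nullary.Decidable using (map′; dec-true)
open import Relation.Unary using (Pred; Decidable)

-- Finite sums, extrema and pigeonhole over the natural numbers.

module ℕ∑ = Algebra.Properties.Semiring.Sum ℕ.+-*-semiring

open ℕ∑ using () renaming (sum to ∑ℕ)

∑ℕ-mono-≤ : ∀ {n} {f g : Vector ℕ n} → (∀ i → f i ℕ.≤ g i) → ∑ℕ f ℕ.≤ ∑ℕ g
∑ℕ-mono-≤ {zero}  f≤g = z≤n
∑ℕ-mono-≤ {suc n} f≤g = ℕ.+-mono-≤ (f≤g zero) (∑ℕ-mono-≤ (f≤g ∘ suc))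

∑ℕ-const : ∀ n c → ∑ℕ {n} (λ _ → c) ≡ n ℕ.* c
∑ℕ-const zero    c = refl
∑ℕ-const (suc n) c = cong (c ℕ.+_) (∑ℕ-const n c)

∑ℕ-1 : ∀ n → ∑ℕ {n} (λ _ → 1) ≡ n
∑ℕ-1 n = trans (∑ℕ-const n 1) (ℕ.*-identityʳ n)

-- The entries other than `f i` already contribute at least 1 each, which leaves at most 1 for
-- `f i`.
∑ℕ≤n⇒≤1 : ∀ {n} (f : Vector ℕ n) → (∀ i → 1 ℕ.≤ f i) → ∑ℕ f ℕ.≤ n → ∀ i → f i ℕ.≤ 1
∑ℕ≤n⇒≤1 {suc n} f 1≤f ∑≤ i = ℕ.+-cancelʳ-≤ n (f i) 1 (begin
  f i ℕ.+ n                      ≡⟨ cong (f i ℕ.+_) (∑ℕ-1 n) ⟨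
  f i ℕ.+ ∑ℕ {n} (λ _ → 1)       ≤⟨ ℕ.+-monoʳ-≤ (f i) (∑ℕ-mono-≤ (1≤f ∘ punchIn i)) ⟩
  f i ℕ.+ ∑ℕ (f ∘ punchIn i)     ≡⟨ ℕ∑.sum-remove f ⟨
  ∑ℕ f                           ≤⟨ ∑≤ ⟩
  suc n                          ∎)
  where open ℕ.≤-Reasoning

-- The inductive step for triangular numbers, doubled to avoid halving. It serves both the exact sum
-- of 0, ..., n - 1 and the bound for gap-free functions.
n*[n∸1]+2n : ∀ n → 2 ℕ.* n ℕ.+ n ℕ.* (n ∸ 1) ≡ suc n ℕ.* n
n*[n∸1]+2n zero    = refl
n*[n∸1]+2n (suc n) = identity n
  where
  identity : ∀ n → 2 ℕ.* suc n ℕ.+ suc n ℕ.* n ≡ suc (suc n) ℕ.* suc n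
  identity = solve-∀

2∑toℕ : ∀ n → 2 ℕ.* ∑ℕ {n} toℕ ≡ n ℕ.* (n ∸ 1)
2∑toℕ zero    = refl
2∑toℕ (suc n) = begin
  2 ℕ.* ∑ℕ {n} (λ i → 1 ℕ.+ toℕ i)               ≡⟨ cong (2 ℕ.*_) (ℕ∑.∑-distrib-+ {n} (λ _ → 1) toℕ) ⟩
  2 ℕ.* (∑ℕ {n} (λ _ → 1) ℕ.+ ∑ℕ {n} toℕ)        ≡⟨ ℕ.*-distribˡ-+ 2 (∑ℕ {n} (λ _ → 1)) _ ⟩
  2 ℕ.* ∑ℕ {n} (λ _ → 1) ℕ.+ 2 ℕ.* ∑ℕ {n} toℕ    ≡⟨ cong₂ ℕ._+_ (cong (2 ℕ.*_) (∑ℕ-1 n)) (2∑toℕ n) ⟩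
  2 ℕ.* n ℕ.+ n ℕ.* (n ∸ 1)                      ≡⟨ n*[n∸1]+2n n ⟩
  suc n ℕ.* n                                    ∎
  where open ≡-Reasoning

argmax : ∀ {n} (f : Vector ℕ (suc n)) → ∃ λ i → ∀ j → f j ℕ.≤ f i
argmax {zero}  f = zero , λ { zero → ℕ.≤-refl }
argmax {suc n} f with argmax (f ∘ suc)
... | i , max with ℕ.≤-total (f zero) (f (suc i))
...   | inj₁ f0≤fi = suc i , λ { zero → f0≤fi ; (suc j) → max j }
...   | inj₂ fi≤f0 = zero , λ { zero → ℕ.≤-refl ; (suc j) → ℕ.≤-trans (max j) fi≤f0 }

-- Linear search upwards from 0, shifting the predicate by one at each failure; the known witness
-- `k` bounds the number of shifts.
least : ∀ {P : Pred ℕ 0ℓ} → Decidable P → ∀ k → P k → ∃ λ m → P m × (∀ j → P j → m ℕ.≤ j)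
least P? zero p = zero , p , λ _ _ → z≤n
least P? (suc k) p with P? 0
... | yes p₀ = zero , p₀ , λ _ _ → z≤n
... | no ¬p₀ with m , pₘ , min ← least (P? ∘ suc) k p =
  suc m , pₘ , λ { zero p₀ → contradiction p₀ ¬p₀ ; (suc j) pⱼ → s≤s (min j pⱼ) }

-- Pigeonhole: if `y` were missed, adjoining it as one more value would inject a set of n + 1
-- elements into one of n.
injective⇒surjective : ∀ {n} {f : Fin n → Fin n} → Injective _≡_ _≡_ f → ∀ y → ∃ λ x → f x ≡ y
injective⇒surjective {n} {f} f-inj y with Fin.any? (λ x → f x Fin.≟ y)
... | yes hit = hit
... | no miss = contradiction (Fin.injective⇒≤ f⁺-injective) (ℕ.<-irrefl refl)
  where
  f⁺ : Fin (suc n) → Fin n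
  f⁺ zero    = y
  f⁺ (suc x) = f x

  f⁺-injective : Injective _≡_ _≡_ f⁺
  f⁺-injective {zero}  {zero}  _ = refl
  f⁺-injective {zero}  {suc x} e = contradiction (x , sym e) miss
  f⁺-injective {suc x} {zero}  e = contradiction (x , e) miss
  f⁺-injective {suc x} {suc z} e = cong suc (f-inj e)

-- Gap-free functions and the largest possible sum of their values.

-- Equivalently, the image of `f` is an initial segment of ℕ. The distances to a fixed vertex are
-- the intended example.
GapFree : ∀ {n} → Vector ℕ n → Set
GapFree f = ∀ u {k} → f u ≡ suc k → ∃ λ w → f w ≡ k

module _ {n} {f : Vector ℕ n} (gap-free : GapFree f) where

  -- Descend from `u` one value at a time until `k` is reached.
  level : ∀ {m} u → f u ≡ m → ∀ {k} → k ℕ.≤ m → ∃ λ w → f w ≡ k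
  level {zero}  u fu≡m z≤n = u , fu≡m
  level {suc m} u fu≡m k≤m with ℕ.m≤n⇒m<n∨m≡n k≤m
  ... | inj₂ refl      = u , fu≡m
  ... | inj₁ (s≤s k≤m) with w , fw≡m ← gap-free u fu≡m = level w fw≡m k≤m

  levels : ∀ {m u} → f u ≡ m → Fin (suc m) → Fin n
  levels fu≡m k = proj₁ (level _ fu≡m (ℕ.<⇒≤pred (Fin.toℕ<n k)))

  levels-section : ∀ {m u} (fu≡m : f u ≡ m) k → f (levels fu≡m k) ≡ toℕ k
  levels-section fu≡m k = proj₂ (level _ fu≡m (ℕ.<⇒≤pred (Fin.toℕ<n k)))

  levels-injective : ∀ {m u} (fu≡m : f u ≡ m) → Injective _≡_ _≡_ (levels fu≡m)
  levels-injective fu≡m {j} {k} e = Fin.toℕ-injective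
    (trans (sym (levels-section fu≡m j)) (trans (cong f e) (levels-section fu≡m k)))

  -- The values 0, ..., `f u` are attained at distinct indices, so there are at least `suc (f u)`
  -- indices.
  gapFree⇒< : ∀ u → f u ℕ.< n
  gapFree⇒< u = Fin.injective⇒≤ (levels-injective {u = u} refl)

-- A witness for a value `k` lying just below another value is never an index of maximal value, so
-- removing such an index destroys no witness.
gapFree-removeMax : ∀ {n} {f : Vector ℕ (suc n)} → GapFree f →
                    ∀ i → (∀ j → f j ℕ.≤ f i) → GapFree (f ∘ punchIn i)
gapFree-removeMax {f = f} gap-free i max u {k} fu≡1+k with gap-free (punchIn i u) fu≡1+k
... | w , fw≡k = punchOut i≢w , trans (cong f (Fin.punchIn-punchOut i≢w)) fw≡k
  where
  i≢w : i ≢ w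
  i≢w refl = ℕ.<-irrefl refl
    (ℕ.≤-trans (ℕ.≤-reflexive (trans (cong suc fw≡k) (sym fu≡1+k))) (max (punchIn i u)))

-- Induction on the number of indices: remove one of maximal value, which is at most the number of
-- remaining indices.
2∑gapFree≤ : ∀ {n} {f : Vector ℕ n} → GapFree f → 2 ℕ.* ∑ℕ f ℕ.≤ n ℕ.* (n ∸ 1)

-- The maximal value `f i` is left unestimated, so that this one inequality yields both the general
-- bound and its equality case.
2∑gapFree≤max : ∀ {n} {f : Vector ℕ (suc n)} → GapFree f → ∀ i → (∀ j → f j ℕ.≤ f i) →
                2 ℕ.* ∑ℕ f ℕ.≤ 2 ℕ.* f i ℕ.+ n ℕ.* (n ∸ 1)
2∑gapFree≤max {n} {f} gap-free i max = begin
  2 ℕ.* ∑ℕ f                                    ≡⟨ cong (2 ℕ.*_) (ℕ∑.sum-remove f) ⟩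
  2 ℕ.* (f i ℕ.+ ∑ℕ (f ∘ punchIn i))            ≡⟨ ℕ.*-distribˡ-+ 2 (f i) _ ⟩
  2 ℕ.* f i ℕ.+ 2 ℕ.* ∑ℕ (f ∘ punchIn i)        ≤⟨ ℕ.+-monoʳ-≤ (2 ℕ.* f i) (2∑gapFree≤ (gapFree-removeMax gap-free i max)) ⟩
  2 ℕ.* f i ℕ.+ n ℕ.* (n ∸ 1)                   ∎
  where open ℕ.≤-Reasoning

2∑gapFree≤ {zero}  gap-free = z≤n
2∑gapFree≤ {suc n} {f} gap-free with i , max ← argmax f = begin
  2 ℕ.* ∑ℕ f                    ≤⟨ 2∑gapFree≤max gap-free i max ⟩
  2 ℕ.* f i ℕ.+ n ℕ.* (n ∸ 1)   ≤⟨ ℕ.+-monoˡ-≤ _ (ℕ.*-monoʳ-≤ 2 (ℕ.<⇒≤pred (gapFree⇒< gap-free i))) ⟩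
  2 ℕ.* n ℕ.+ n ℕ.* (n ∸ 1)     ≡⟨ n*[n∸1]+2n n ⟩
  suc n ℕ.* n                   ∎
  where open ℕ.≤-Reasoning

-- The values other than the maximum account for at most half of n (n - 1), so equality forces the
-- maximum up to n.
2∑gapFree-extremal : ∀ {n} {f : Vector ℕ (suc n)} → GapFree f →
                     2 ℕ.* ∑ℕ f ≡ suc n ℕ.* n → ∃ λ u → f u ≡ n
2∑gapFree-extremal {n} {f} gap-free eq with i , max ← argmax f =
  i , ℕ.≤-antisym (ℕ.<⇒≤pred (gapFree⇒< gap-free i))
        (ℕ.*-cancelˡ-≤ 2 (ℕ.+-cancelʳ-≤ (n ℕ.* (n ∸ 1)) _ _ bound))
  where
  open ℕ.≤-Reasoning
  bound : 2 ℕ.* n ℕ.+ n ℕ.* (n ∸ 1) ℕ.≤ 2 ℕ.* f i ℕ.+ n ℕ.* (n ∸ 1)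
  bound = begin
    2 ℕ.* n ℕ.+ n ℕ.* (n ∸ 1)     ≡⟨ n*[n∸1]+2n n ⟩
    suc n ℕ.* n                   ≡⟨ eq ⟨
    2 ℕ.* ∑ℕ f                    ≤⟨ 2∑gapFree≤max gap-free i max ⟩
    2 ℕ.* f i ℕ.+ n ℕ.* (n ∸ 1)   ∎

-- Walks, graph distance and transmission.

-- The length is an index, so that distance is the least inhabited length and each length can be
-- decided separately.
data Walk {n} (G : Graph n) : ℕ → Fin n → Fin n → Set where
  []  : ∀ {u} → Walk G 0 u u
  _∷_ : ∀ {k u w v} → Adj G u w → Walk G k w v → Walk G (suc k) u v

module _ {n} {G : Graph n} where

  infixr 5 _++_

  _++_ : ∀ {j k u w v} → Walk G j u w → Walk G k w v → Walk G (j ℕ.+ k) u v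
  []      ++ q = q
  (a ∷ p) ++ q = a ∷ (p ++ q)

  reverse : ∀ {k u v} → Walk G k u v → Walk G k v u
  reverse []                  = []
  reverse {v = v} (_∷_ {k} {u} a p) =
    subst (λ l → Walk G l v u) (ℕ.+-comm k 1) (reverse p ++ (symm G a ∷ []))

  fromStar : ∀ {u v} → Star (Adj G) u v → ∃ λ k → Walk G k u v
  fromStar Star.ε       = 0 , []
  fromStar (a ◅ s) with k , p ← fromStar s = suc k , a ∷ p

  -- Recursion on the length, with a search over the finitely many first steps. This is what makes
  -- `least` applicable to walk lengths.
  walk? : ∀ u v → Decidable (λ k → Walk G k u v)
  walk? u v zero    = map′ (λ { refl → [] }) (λ { [] → refl }) (u Fin.≟ v)
  walk? u v (suc k) = map′ (λ { (w , a , p) → a ∷ p }) (λ { (a ∷ p) → _ , a , p })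
    (Fin.any? λ w → adj? G u w ×-dec walk? w v k)

module Distance {n} (G : Graph n) (conn : Connected G) where

  opaque

    -- Connectedness supplies some walk, and its length starts the search. Being opaque, the
    -- distance is known afterwards only through a shortest walk and its minimality.
    shortest : ∀ u v → ∃ λ m → Walk G m u v × (∀ j → Walk G j u v → m ℕ.≤ j)
    shortest u v with k , p ← fromStar (conn u v) = least (walk? u v) k p

  d : Fin n → Fin n → ℕ
  d u v = proj₁ (shortest u v)

  geodesic : ∀ u v → Walk G (d u v) u v
  geodesic u v = proj₁ (proj₂ (shortest u v))

  d-minimal : ∀ {k u v} → Walk G k u v → d u v ℕ.≤ k
  d-minimal {k} {u} {v} = proj₂ (proj₂ (shortest u v)) k

  d-refl : ∀ v → d v v ≡ 0
  d-refl v = ℕ.n≤0⇒n≡0 (d-minimal [])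

  d-sym : ∀ u v → d u v ≡ d v u
  d-sym u v = ℕ.≤-antisym (d-minimal (reverse (geodesic v u))) (d-minimal (reverse (geodesic u v)))

  d-triangle : ∀ u w v → d u v ℕ.≤ d u w ℕ.+ d w v
  d-triangle u w v = d-minimal (geodesic u w ++ geodesic w v)

  d-adj : ∀ {u w} v → Adj G u w → d u v ℕ.≤ suc (d w v)
  d-adj v a = d-minimal (a ∷ geodesic _ v)

  d-positive : ∀ {u v} → u ≢ v → 1 ℕ.≤ d u v
  d-positive {u} {v} u≢v with d u v | geodesic u v
  ... | zero  | []    = contradiction refl u≢v
  ... | suc _ | _ ∷ _ = s≤s z≤n

  -- Take the second vertex of a geodesic: the tail of the walk bounds its distance above, and
  -- `d-adj` bounds it below.
  predecessor : ∀ u v {k} → d u v ≡ suc k → ∃ λ w → Adj G u w × d w v ≡ k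
  predecessor u v {k} eq with subst (λ l → Walk G l u v) eq (geodesic u v)
  ... | _∷_ {w = w} a p = w , a , ℕ.≤-antisym (d-minimal p)
    (ℕ.≤-pred (ℕ.≤-trans (ℕ.≤-reflexive (sym eq)) (d-adj v a)))

  d-gapFree : ∀ v → GapFree (λ u → d u v)
  d-gapFree v u eq with w , _ , e ← predecessor u v eq = w , e

  d≤1⇒adj : ∀ {u v} → u ≢ v → d u v ℕ.≤ 1 → Adj G u v
  d≤1⇒adj {u} {v} u≢v d≤1 with d u v | geodesic u v
  ... | zero        | []     = contradiction refl u≢v
  ... | suc zero    | a ∷ [] = a
  d≤1⇒adj u≢v (s≤s ()) | suc (suc _) | _

  transmission : Fin n → ℕ
  transmission v = ∑ℕ λ u → d u v

  -- Sum the triangle inequality over all choices of the middle vertex.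
  n*d≤transmissions : ∀ u v → n ℕ.* d u v ℕ.≤ transmission u ℕ.+ transmission v
  n*d≤transmissions u v = begin
    n ℕ.* d u v                          ≡⟨ ∑ℕ-const n (d u v) ⟨
    ∑ℕ {n} (λ _ → d u v)                 ≤⟨ ∑ℕ-mono-≤ (λ w → subst (λ k → d u v ℕ.≤ k ℕ.+ d w v) (d-sym u w) (d-triangle u w v)) ⟩
    ∑ℕ (λ w → d w u ℕ.+ d w v)           ≡⟨ ℕ∑.∑-distrib-+ (λ w → d w u) (λ w → d w v) ⟩
    transmission u ℕ.+ transmission v    ∎
    where open ℕ.≤-Reasoning

  2transmission≤ : ∀ v → 2 ℕ.* transmission v ℕ.≤ n ℕ.* (n ∸ 1)
  2transmission≤ v = 2∑gapFree≤ (d-gapFree v)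

-- Extremal transmissions: paths and complete graphs.

module _ {n} (G : Graph (suc n)) (conn : Connected G) where

  open Distance G conn

  -- Equality produces a vertex at distance n from `v`. Each of the distances 0, ..., n then occurs
  -- at exactly one of the n + 1 vertices, and numbering vertices by distance is the isomorphism.
  extremal⇒path : ∀ v → 2 ℕ.* transmission v ≡ suc n ℕ.* n → G ≅ path (suc n)
  extremal⇒path v eq with end , d≡n ← 2∑gapFree-extremal (d-gapFree v) eq = record
    { bijection = mk↔ₛ′ position vertex position-vertex vertex-position
    ; preserves = λ u w → mk⇔ (adj⇒consecutive u w) (consecutive⇒adj u w)
    }
    where
    position : Fin (suc n) → Fin (suc n)
    position u = fromℕ< (gapFree⇒< (d-gapFree v) u)

    toℕ-position : ∀ u → toℕ (position u) ≡ d u v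
    toℕ-position u = Fin.toℕ-fromℕ< (gapFree⇒< (d-gapFree v) u)

    vertex : Fin (suc n) → Fin (suc n)
    vertex = levels (d-gapFree v) d≡n

    position-vertex : ∀ k → position (vertex k) ≡ k
    position-vertex k = Fin.toℕ-injective
      (trans (toℕ-position (vertex k)) (levels-section (d-gapFree v) d≡n k))

    vertex-position : ∀ u → vertex (position u) ≡ u
    -- An injection of a finite set into itself is onto, so the section `vertex` is a two-sided
    -- inverse.
    vertex-position u with k , vk≡u ← injective⇒surjective (levels-injective (d-gapFree v) d≡n) u =
      trans (cong (vertex ∘ position) (sym vk≡u)) (trans (cong vertex (position-vertex k)) vk≡u)

    d-injective : ∀ {u w} → d u v ≡ d w v → u ≡ w
    d-injective {u} {w} e = trans (sym (vertex-position u)) (trans (cong vertex (Fin.toℕ-injective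
      (trans (toℕ-position u) (trans e (sym (toℕ-position w)))))) (vertex-position w))

    step : ∀ {u w} → Adj G u w → d u v ≡ suc (d w v) ⊎ d u v ℕ.≤ d w v
    step a with ℕ.m≤n⇒m<n∨m≡n (d-adj v a)
    ... | inj₁ (s≤s du≤dw) = inj₂ du≤dw
    ... | inj₂ e           = inj₁ e

    adj⇒consecutive : ∀ u w → Adj G u w → Adj (path (suc n)) (position u) (position w)
    adj⇒consecutive u w a =
      subst₂ (λ j k → k ≡ suc j ⊎ j ≡ suc k) (sym (toℕ-position u)) (sym (toℕ-position w)) consecutive
      where
      consecutive : d w v ≡ suc (d u v) ⊎ d u v ≡ suc (d w v)
      consecutive with step a | step (symm G a)
      ... | inj₁ e  | _       = inj₂ e
      ... | inj₂ _  | inj₁ e  = inj₁ e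
      -- Here both vertices have the same distance to `v`, so they coincide and cannot be adjacent.
      ... | inj₂ le | inj₂ ge = contradiction a (irrefl G (d-injective (ℕ.≤-antisym le ge)))

    -- A geodesic from `u` first visits a vertex at the distance of `w`, and `w` is the only such
    -- vertex.
    successor⇒adj : ∀ {u w} → d u v ≡ suc (d w v) → Adj G u w
    successor⇒adj {u} e with x , a , dx≡dw ← predecessor u v e =
      subst (Adj G u) (d-injective dx≡dw) a

    consecutive⇒adj : ∀ u w → Adj (path (suc n)) (position u) (position w) → Adj G u w
    consecutive⇒adj u w c
      with subst₂ (λ j k → k ≡ suc j ⊎ j ≡ suc k) (toℕ-position u) (toℕ-position w) c
    ... | inj₁ e = symm G (successor⇒adj e)
    ... | inj₂ e = successor⇒adj e

  -- An end of the path is at distance at least i from the vertex numbered i, so its transmission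
  -- reaches the universal upper bound, and so does the maximal one.
  path⇒extremal : G ≅ path (suc n) → ∀ c → (∀ v → transmission v ℕ.≤ transmission c) →
                  2 ℕ.* transmission c ≡ suc n ℕ.* n
  path⇒extremal iso c farthest = ℕ.≤-antisym (2transmission≤ c) (begin
    suc n ℕ.* n                      ≡⟨ 2∑toℕ (suc n) ⟨
    2 ℕ.* ∑ℕ {suc n} toℕ             ≡⟨ cong (2 ℕ.*_) (ℕ∑.sum-permute {suc n} toℕ bijection) ⟩
    2 ℕ.* ∑ℕ (toℕ ∘ to)              ≤⟨ ℕ.*-monoʳ-≤ 2 (∑ℕ-mono-≤ position≤d) ⟩
    2 ℕ.* transmission v             ≤⟨ ℕ.*-monoʳ-≤ 2 (farthest v) ⟩
    2 ℕ.* transmission c             ∎)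
    where
    open ℕ.≤-Reasoning
    open _≅_ iso
    open Inverse bijection using (to; from; strictlyInverseˡ)

    v : Fin (suc n)
    -- The vertex corresponding to the end 0 of the path.
    v = from zero

    -- Adjacent vertices carry consecutive numbers, so each step lowers the number by at most one.
    walk-position : ∀ {k u w} → Walk G k u w → toℕ (to u) ℕ.≤ k ℕ.+ toℕ (to w)
    walk-position []                      = ℕ.≤-refl
    walk-position (_∷_ {u = u} {w} a p) with Equivalence.to (preserves u w) a
    ... | inj₁ e = ℕ.m≤n⇒m≤1+n (ℕ.≤-trans (ℕ.n≤1+n _) (ℕ.≤-trans (ℕ.≤-reflexive (sym e)) (walk-position p)))
    ... | inj₂ e = ℕ.≤-trans (ℕ.≤-reflexive e) (s≤s (walk-position p))

    position≤d : ∀ u → toℕ (to u) ℕ.≤ d u v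
    position≤d u = begin
      toℕ (to u)                  ≤⟨ walk-position (geodesic u v) ⟩
      d u v ℕ.+ toℕ (to v)        ≡⟨ cong (λ i → d u v ℕ.+ toℕ i) (strictlyInverseˡ zero) ⟩
      d u v ℕ.+ 0                 ≡⟨ ℕ.+-identityʳ _ ⟩
      d u v                       ∎

  private
    -- The zero term of `v` itself is dropped; the n remaining distances are all positive.
    d-others : Fin (suc n) → Vector ℕ n
    d-others v j = d (punchIn v j) v

    transmission-others : ∀ v → transmission v ≡ ∑ℕ (d-others v)
    transmission-others v = trans (ℕ∑.sum-remove {i = v} (λ u → d u v)) (cong (ℕ._+ ∑ℕ (d-others v)) (d-refl v))

    1≤d-others : ∀ v j → 1 ℕ.≤ d-others v j
    1≤d-others v j = d-positive (Fin.punchInᵢ≢i v j)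

  n≤transmission : ∀ v → n ℕ.≤ transmission v
  n≤transmission v = begin
    n                      ≡⟨ ∑ℕ-1 n ⟨
    ∑ℕ {n} (λ _ → 1)       ≤⟨ ∑ℕ-mono-≤ (1≤d-others v) ⟩
    ∑ℕ (d-others v)        ≡⟨ transmission-others v ⟨
    transmission v         ∎
    where open ℕ.≤-Reasoning

  complete⇒transmission≤ : G ≅ complete (suc n) → ∀ v → transmission v ℕ.≤ n
  complete⇒transmission≤ iso v = begin
    transmission v         ≡⟨ transmission-others v ⟩
    ∑ℕ (d-others v)        ≤⟨ ∑ℕ-mono-≤ (λ j → d-minimal (others-adj j ∷ [])) ⟩
    ∑ℕ {n} (λ _ → 1)       ≡⟨ ∑ℕ-1 n ⟩
    n                      ∎
    where
    open ℕ.≤-Reasoning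
    open _≅_ iso
    others-adj : ∀ j → Adj G (punchIn v j) v
    others-adj j = Equivalence.from (preserves _ _)
      (Fin.punchInᵢ≢i v j ∘ Injection.injective (↔⇒↣ bijection))

  -- The n distances from the other vertices are each at least 1 and sum to at most n, so each
  -- equals 1 and every pair of distinct vertices is adjacent.
  transmission≤⇒complete : (∀ v → transmission v ℕ.≤ n) → G ≅ complete (suc n)
  transmission≤⇒complete t≤n = record
    { bijection = mk↔ₛ′ (λ u → u) (λ u → u) (λ _ → refl) (λ _ → refl)
    ; preserves = λ u v → mk⇔ (λ a u≡v → irrefl G u≡v a) (adj u v)
    }
    where
    adj : ∀ u v → u ≢ v → Adj G u v
    adj u v u≢v = d≤1⇒adj u≢v (subst (λ w → d w v ℕ.≤ 1) (Fin.punchIn-punchOut (u≢v ∘ sym))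
      (∑ℕ≤n⇒≤1 (d-others v) (1≤d-others v)
        (subst (ℕ._≤ n) (transmission-others v) (t≤n v)) (punchOut (u≢v ∘ sym))))

-- Fractions and the embedding of ℕ into ℚ.

fromℚᵘ-homo-+ : ∀ p q → fromℚᵘ (p ℚᵘ.+ q) ≡ fromℚᵘ p ℚ.+ fromℚᵘ q
fromℚᵘ-homo-+ p q = ℚ.toℚᵘ-injective (begin
  toℚᵘ (fromℚᵘ (p ℚᵘ.+ q))                 ≈⟨ ℚ.toℚᵘ-fromℚᵘ (p ℚᵘ.+ q) ⟩
  p ℚᵘ.+ q                                 ≈⟨ ℚᵘ.+-cong (ℚ.toℚᵘ-fromℚᵘ p) (ℚ.toℚᵘ-fromℚᵘ q) ⟨
  toℚᵘ (fromℚᵘ p) ℚᵘ.+ toℚᵘ (fromℚᵘ q)     ≈⟨ ℚ.toℚᵘ-homo-+ (fromℚᵘ p) (fromℚᵘ q) ⟨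
  toℚᵘ (fromℚᵘ p ℚ.+ fromℚᵘ q)             ∎)
  where open ℚᵘ.≃-Reasoning

fromℚᵘ-homo-* : ∀ p q → fromℚᵘ (p ℚᵘ.* q) ≡ fromℚᵘ p ℚ.* fromℚᵘ q
fromℚᵘ-homo-* p q = ℚ.toℚᵘ-injective (begin
  toℚᵘ (fromℚᵘ (p ℚᵘ.* q))                 ≈⟨ ℚ.toℚᵘ-fromℚᵘ (p ℚᵘ.* q) ⟩
  p ℚᵘ.* q                                 ≈⟨ ℚᵘ.*-cong (ℚ.toℚᵘ-fromℚᵘ p) (ℚ.toℚᵘ-fromℚᵘ q) ⟨
  toℚᵘ (fromℚᵘ p) ℚᵘ.* toℚᵘ (fromℚᵘ q)     ≈⟨ ℚ.toℚᵘ-homo-* (fromℚᵘ p) (fromℚᵘ q) ⟨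
  toℚᵘ (fromℚᵘ p ℚ.* fromℚᵘ q)             ∎)
  where open ℚᵘ.≃-Reasoning

/-≡ : ∀ a b .{{_ : NonZero b}} c d .{{_ : NonZero d}} → a ℕ.* d ≡ c ℕ.* b → + a / b ≡ + c / d
/-≡ a (suc b) c (suc d) eq = ℚ.fromℚᵘ-cong {mkℚᵘ (+ a) b} {mkℚᵘ (+ c) d}
  (ℚᵘ.*≡* (trans (sym (ℤ.pos-* a (suc d))) (trans (cong +_ eq) (ℤ.pos-* c (suc b)))))

/-≡⁻¹ : ∀ a b .{{_ : NonZero b}} c d .{{_ : NonZero d}} → + a / b ≡ + c / d → a ℕ.* d ≡ c ℕ.* b
/-≡⁻¹ a (suc b) c (suc d) eq with ℚ.fromℚᵘ-injective {mkℚᵘ (+ a) b} {mkℚᵘ (+ c) d} eq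
... | ℚᵘ.*≡* eq = ℤ.+-injective (trans (ℤ.pos-* a (suc d)) (trans eq (sym (ℤ.pos-* c (suc b)))))

/-≤ : ∀ a b .{{_ : NonZero b}} c d .{{_ : NonZero d}} → a ℕ.* d ℕ.≤ c ℕ.* b → + a / b ℚ.≤ + c / d
/-≤ a (suc b) c (suc d) le = ℚ.toℚᵘ-cancel-≤
  (ℚᵘ.≤-respˡ-≃ (ℚᵘ.≃-sym (ℚ.toℚᵘ-fromℚᵘ (mkℚᵘ (+ a) b)))
  (ℚᵘ.≤-respʳ-≃ (ℚᵘ.≃-sym (ℚ.toℚᵘ-fromℚᵘ (mkℚᵘ (+ c) d)))
  (ℚᵘ.*≤* (subst₂ ℤ._≤_ (ℤ.pos-* a (suc d)) (ℤ.pos-* c (suc b)) (ℤ.+≤+ le)))))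

-- Opaque because unfolding normalises fractions by gcd, which makes conversion checking explode.
opaque

  ι : ℕ → ℚ
  ι k = + k / 1

  ι-0 : ι 0 ≡ 0ℚ
  ι-0 = refl

  ι-1 : ι 1 ≡ 1ℚ
  ι-1 = refl

  /-*ι : ∀ a b .{{_ : NonZero b}} c → + a / b ℚ.* ι c ≡ + (a ℕ.* c) / b
  /-*ι a (suc b) c = begin
    + a / suc b ℚ.* ι c                            ≡⟨ fromℚᵘ-homo-* (mkℚᵘ (+ a) b) (mkℚᵘ (+ c) 0) ⟨
    fromℚᵘ (mkℚᵘ (+ a) b ℚᵘ.* mkℚᵘ (+ c) 0)        ≡⟨⟩
    (+ a ℤ.* + c) / (suc b ℕ.* 1)                  ≡⟨ cong (λ k → k / (suc b ℕ.* 1)) (ℤ.pos-* a c) ⟨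
    -- The unnormalised product has denominator `suc b ℕ.* 1`, which still has to be simplified.
    + (a ℕ.* c) / (suc b ℕ.* 1)                    ≡⟨ /-≡ (a ℕ.* c) (suc b ℕ.* 1) (a ℕ.* c) (suc b) (cong (a ℕ.* c ℕ.*_) (sym (ℕ.*-identityʳ (suc b)))) ⟩
    + (a ℕ.* c) / suc b                            ∎
    where open ≡-Reasoning

  /-cancel : ∀ a b .{{_ : NonZero b}} → + a / b ℚ.* ι b ≡ ι a
  /-cancel a b = trans (/-*ι a b b) (/-≡ (a ℕ.* b) b a 1 (ℕ.*-identityʳ (a ℕ.* b)))

  /-≤ι : ∀ a b .{{_ : NonZero b}} c → a ℕ.≤ c ℕ.* b → + a / b ℚ.≤ ι c
  /-≤ι a b c a≤cb = /-≤ a b c 1 (ℕ.≤-trans (ℕ.≤-reflexive (ℕ.*-identityʳ a)) a≤cb)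

  ι-+ : ∀ a b → ι (a ℕ.+ b) ≡ ι a ℚ.+ ι b
  ι-+ a b = begin
    + (a ℕ.+ b) / 1                                ≡⟨ cong (λ k → k / 1) (cong₂ ℤ._+_ (ℤ.*-identityʳ (+ a)) (ℤ.*-identityʳ (+ b))) ⟨
    (+ a ℤ.* + 1 ℤ.+ + b ℤ.* + 1) / 1              ≡⟨ fromℚᵘ-homo-+ (mkℚᵘ (+ a) 0) (mkℚᵘ (+ b) 0) ⟩
    ι a ℚ.+ ι b                                    ∎
    where open ≡-Reasoning

  ι-mono-≤ : ∀ {a b} → a ℕ.≤ b → ι a ℚ.≤ ι b
  ι-mono-≤ {a} {b} a≤b = /-≤ a 1 b 1 (ℕ.*-monoˡ-≤ 1 a≤b)

0≤ι : ∀ k → 0ℚ ℚ.≤ ι k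
0≤ι k = subst (ℚ._≤ ι k) ι-0 (ι-mono-≤ z≤n)

ι-suc : ∀ k → ι (suc k) ≡ 1ℚ ℚ.+ ι k
ι-suc k = trans (ι-+ 1 k) (cong (ℚ._+ ι k) ι-1)

ι-nonNeg : ∀ k → ℚ.NonNegative (ι k)
ι-nonNeg k = ℚ.nonNegative (0≤ι k)

-- Sums and absolute values of rationals.

module ℚ∑ = Algebra.Properties.Semiring.Sum
  (CommutativeRing.semiring ℚ.+-*-commutativeRing)

open ℚ∑ using () renaming (sum to ∑ℚ)

∑ℚ-mono-≤ : ∀ {n} {f g : Vector ℚ n} → (∀ i → f i ℚ.≤ g i) → ∑ℚ f ℚ.≤ ∑ℚ g
∑ℚ-mono-≤ {zero}  f≤g = ℚ.≤-refl
∑ℚ-mono-≤ {suc n} f≤g = ℚ.+-mono-≤ (f≤g zero) (∑ℚ-mono-≤ (f≤g ∘ suc))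

∣∑ℚ∣≤∑ℚ∣∣ : ∀ {n} (f : Vector ℚ n) → ℚ.∣ ∑ℚ f ∣ ℚ.≤ ∑ℚ (λ i → ℚ.∣ f i ∣)
∣∑ℚ∣≤∑ℚ∣∣ {zero}  f = ℚ.≤-refl
∣∑ℚ∣≤∑ℚ∣∣ {suc n} f = ℚ.≤-trans (ℚ.∣p+q∣≤∣p∣+∣q∣ (f zero) (∑ℚ (f ∘ suc)))
  (ℚ.+-monoʳ-≤ ℚ.∣ f zero ∣ (∣∑ℚ∣≤∑ℚ∣∣ (f ∘ suc)))

∑ℚ-const : ∀ n c → ∑ℚ {n} (λ _ → c) ≡ ι n ℚ.* c
∑ℚ-const zero    c = sym (trans (cong (ℚ._* c) ι-0) (ℚ.*-zeroˡ c))
∑ℚ-const (suc n) c = begin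
  c ℚ.+ ∑ℚ {n} (λ _ → c)      ≡⟨ cong₂ ℚ._+_ (sym (ℚ.*-identityˡ c)) (∑ℚ-const n c) ⟩
  1ℚ ℚ.* c ℚ.+ ι n ℚ.* c      ≡⟨ ℚ.*-distribʳ-+ c 1ℚ (ι n) ⟨
  (1ℚ ℚ.+ ι n) ℚ.* c          ≡⟨ cong (ℚ._* c) (ι-suc n) ⟨
  ι (suc n) ℚ.* c             ∎
  where open ≡-Reasoning

∑ℚ-ι : ∀ {n} (f : Vector ℕ n) → ∑ℚ (λ i → ι (f i)) ≡ ι (∑ℕ f)
∑ℚ-ι {zero}  f = sym ι-0
∑ℚ-ι {suc n} f = trans (cong (ι (f zero) ℚ.+_) (∑ℚ-ι (f ∘ suc))) (sym (ι-+ (f zero) _))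

p⊔-p≡∣p∣ : ∀ p → p ℚ.⊔ ℚ.- p ≡ ℚ.∣ p ∣
p⊔-p≡∣p∣ p with ℚ.≤-total 0ℚ p
... | inj₁ 0≤p = trans (ℚ.p≥q⇒p⊔q≡p (ℚ.≤-trans (ℚ.neg-antimono-≤ 0≤p) 0≤p)) (sym (ℚ.0≤p⇒∣p∣≡p 0≤p))
... | inj₂ p≤0 = trans (ℚ.p≤q⇒p⊔q≡q (ℚ.≤-trans p≤0 (ℚ.neg-antimono-≤ p≤0)))
  (trans (sym (ℚ.0≤p⇒∣p∣≡p (ℚ.neg-antimono-≤ p≤0))) (ℚ.∣-p∣≡∣p∣ p))

p≤∣p∣ : ∀ p → p ℚ.≤ ℚ.∣ p ∣
p≤∣p∣ p = ℚ.≤-trans (ℚ.p≤p⊔q p (ℚ.- p)) (ℚ.≤-reflexive (p⊔-p≡∣p∣ p))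

-[p-q]≡q-p : ∀ p q → ℚ.- (p ℚ.- q) ≡ q ℚ.- p
-[p-q]≡q-p = solve 2 (λ p q → :- (p :- q) := q :- p) refl
  where open +-*-Solver

p≡p-q+q : ∀ p q → p ≡ (p ℚ.- q) ℚ.+ q
p≡p-q+q = solve 2 (λ p q → p := (p :- q) :+ q) refl
  where open +-*-Solver

∣p-q∣≡∣q-p∣ : ∀ p q → ℚ.∣ p ℚ.- q ∣ ≡ ℚ.∣ q ℚ.- p ∣
∣p-q∣≡∣q-p∣ p q = trans (sym (ℚ.∣-p∣≡∣p∣ (p ℚ.- q))) (cong ℚ.∣_∣ (-[p-q]≡q-p p q))

-- Real sums and maxima at a fixed approximation index.

module _ (i : ℕ) where

  -- The real operations act termwise on approximants, so the estimates can be carried out in ℚ at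
  -- each index `i`.
  seq-∑ : ∀ {n} (x : Vector ℝ n) → seq (∑ x) i ≡ ∑ℚ (λ v → seq (x v) i)
  seq-∑ {zero}  x = refl
  seq-∑ {suc n} x = cong (seq (x zero) i ℚ.+_) (seq-∑ (x ∘ suc))

  -- A binary maximum equals one of its arguments, so a finite one is an entry or the initial 0;
  -- hence the requirement `P 0ℚ`.
  seq-⨆-elim : ∀ {n} (P : Pred ℚ 0ℓ) (x : Vector ℝ n) → P 0ℚ → (∀ v → P (seq (x v) i)) → P (seq (⨆ x) i)
  seq-⨆-elim {zero}  P x p₀ p = p₀
  seq-⨆-elim {suc n} P x p₀ p with ℚ.⊔-sel (seq (x zero) i) (seq (⨆ (x ∘ suc)) i)
  ... | inj₁ e = subst P (sym e) (p zero)
  ... | inj₂ e = subst P (sym e) (seq-⨆-elim P (x ∘ suc) p₀ (p ∘ suc))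

  0≤seq-⨆ : ∀ {n} (x : Vector ℝ n) → 0ℚ ℚ.≤ seq (⨆ x) i
  0≤seq-⨆ {zero}  x = ℚ.≤-refl
  0≤seq-⨆ {suc n} x = ℚ.≤-trans (0≤seq-⨆ (x ∘ suc)) (ℚ.p≤q⊔p (seq (x zero) i) _)

  seq-⨆-upper : ∀ {n} (x : Vector ℝ n) v → seq (x v) i ℚ.≤ seq (⨆ x) i
  seq-⨆-upper x zero    = ℚ.p≤p⊔q _ _
  seq-⨆-upper x (suc v) = ℚ.≤-trans (seq-⨆-upper (x ∘ suc) v) (ℚ.p≤q⊔p (seq (x zero) i) _)

  seq-γₓ-upper : ∀ {n} (G : Graph n) (x : Vector ℝ n) {u v} → Adj G u v →
                 ℚ.∣ seq (x u) i ℚ.- seq (x v) i ∣ ℚ.≤ seq (γₓ G x) i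
  seq-γₓ-upper {n} G x {u} {v} a = begin
    ℚ.∣ seq (x u) i ℚ.- seq (x v) i ∣     ≡⟨ p⊔-p≡∣p∣ _ ⟨
    seq ∣ x u - x v ∣ i                   ≡⟨ cong (λ b → seq (if b then ∣ x u - x v ∣ else 0ℝ) i) (dec-true (adj? G u v) a) ⟨
    seq (edge u v) i                      ≤⟨ seq-⨆-upper (edge u) v ⟩
    seq (⨆ (edge u)) i                    ≤⟨ seq-⨆-upper (λ u → ⨆ (edge u)) u ⟩
    seq (γₓ G x) i                        ∎
    where
    open ℚ.≤-Reasoning
    edge : Fin n → Vector ℝ n
    edge u v = if does (adj? G u v) then ∣ x u - x v ∣ else 0ℝ

  seq-γₓ-least : ∀ {n} (G : Graph n) (x : Vector ℝ n) {c} → 0ℚ ℚ.≤ c →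
                 (∀ u v → Adj G u v → ℚ.∣ seq (x u) i ℚ.- seq (x v) i ∣ ℚ.≤ c) → seq (γₓ G x) i ℚ.≤ c
  seq-γₓ-least G x {c} 0≤c bound =
    seq-⨆-elim (ℚ._≤ c) _ 0≤c λ u → seq-⨆-elim (ℚ._≤ c) _ 0≤c λ v → edge≤ u v
    where
    edge≤ : ∀ u v → seq (if does (adj? G u v) then ∣ x u - x v ∣ else 0ℝ) i ℚ.≤ c
    edge≤ u v with adj? G u v
    ... | yes a = ℚ.≤-trans (ℚ.≤-reflexive (p⊔-p≡∣p∣ _)) (bound u v a)
    ... | no  _ = 0≤c

-- Rational constants as real numbers.

≗⇒≃ : ∀ (x y : ℝ) → (∀ i → seq x i ≡ seq y i) → x ≃ y
≗⇒≃ x y x≗y ε 0<ε = 0 , λ i _ →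
  ℚ.≤-<-trans (ℚ.≤-reflexive (cong ℚ.∣_∣ (trans (cong (ℚ._- seq y i) (x≗y i)) (ℚ.+-inverseʳ (seq y i))))) 0<ε

fromℚ-mono-≤ : ∀ {p q} → p ℚ.≤ q → fromℚ p ≤ fromℚ q
fromℚ-mono-≤ {p} {q} p≤q ε 0<ε = 0 , λ _ _ →
  ℚ.≤-<-trans (subst (p ℚ.- q ℚ.≤_) (ℚ.+-inverseʳ q) (ℚ.+-monoˡ-≤ (ℚ.- q) p≤q)) 0<ε

fromℚ-cong : ∀ {p q} → p ≡ q → fromℚ p ≃ fromℚ q
fromℚ-cong {p} refl = ≗⇒≃ (fromℚ p) (fromℚ p) (λ _ → refl)

-- If the distance between `p` and `q` were positive, using it as the tolerance would make it
-- smaller than itself.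
fromℚ-injective : ∀ {p q} → fromℚ p ≃ fromℚ q → p ≡ q
fromℚ-injective {p} {q} p≃q with ℚ.∣ p ℚ.- q ∣ ℚ.≤? 0ℚ
... | no ∣∣≰0 with N , close ← p≃q ℚ.∣ p ℚ.- q ∣ (ℚ.≰⇒> ∣∣≰0) =
  contradiction (close N ℕ.≤-refl) (ℚ.<-irrefl refl)
... | yes ∣∣≤0 = ℚ.≤-antisym (difference≤0 p q ∣∣≤0)
    (difference≤0 q p (subst (ℚ._≤ 0ℚ) (∣p-q∣≡∣q-p∣ p q) ∣∣≤0))
  where
  difference≤0 : ∀ p q → ℚ.∣ p ℚ.- q ∣ ℚ.≤ 0ℚ → p ℚ.≤ q
  difference≤0 p q ∣∣≤0 = begin
    p                     ≡⟨ p≡p-q+q p q ⟩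
    (p ℚ.- q) ℚ.+ q       ≤⟨ ℚ.+-monoˡ-≤ q (ℚ.≤-trans (p≤∣p∣ (p ℚ.- q)) ∣∣≤0) ⟩
    0ℚ ℚ.+ q              ≡⟨ ℚ.+-identityˡ q ⟩
    q                     ∎
    where open ℚ.≤-Reasoning

-- The value n / D: lower bound and attainment.

module _ {n} (G : Graph n) (conn : Connected G) where

  open Distance G conn

  module _ (y : Vector ℚ n) {g : ℚ} (edge≤g : ∀ {u v} → Adj G u v → ℚ.∣ y u ℚ.- y v ∣ ℚ.≤ g) where

    open ℚ.≤-Reasoning

    walk-lipschitz : ∀ {k u v} → Walk G k u v → ℚ.∣ y u ℚ.- y v ∣ ℚ.≤ ι k ℚ.* g
    walk-lipschitz {u = u} [] =
      ℚ.≤-reflexive (trans (cong ℚ.∣_∣ (ℚ.+-inverseʳ (y u))) (sym (trans (cong (ℚ._* g) ι-0) (ℚ.*-zeroˡ g))))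
    walk-lipschitz {suc k} {u} {v} (_∷_ {w = w} a p) = begin
      ℚ.∣ y u ℚ.- y v ∣                               ≡⟨ cong ℚ.∣_∣ (identity (y u) (y w) (y v)) ⟩
      ℚ.∣ (y u ℚ.- y w) ℚ.+ (y w ℚ.- y v) ∣           ≤⟨ ℚ.∣p+q∣≤∣p∣+∣q∣ (y u ℚ.- y w) (y w ℚ.- y v) ⟩
      ℚ.∣ y u ℚ.- y w ∣ ℚ.+ ℚ.∣ y w ℚ.- y v ∣         ≤⟨ ℚ.+-mono-≤ (edge≤g a) (walk-lipschitz p) ⟩
      g ℚ.+ ι k ℚ.* g                                 ≡⟨ cong (ℚ._+ ι k ℚ.* g) (ℚ.*-identityˡ g) ⟨
      1ℚ ℚ.* g ℚ.+ ι k ℚ.* g                          ≡⟨ ℚ.*-distribʳ-+ g 1ℚ (ι k) ⟨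
      (1ℚ ℚ.+ ι k) ℚ.* g                              ≡⟨ cong (ℚ._* g) (ι-suc k) ⟨
      ι (suc k) ℚ.* g                                 ∎
      where
      open +-*-Solver
      identity : ∀ p q r → p ℚ.- r ≡ (p ℚ.- q) ℚ.+ (q ℚ.- r)
      identity = solve 3 (λ p q r → p :- r := (p :- q) :+ (q :- r)) refl

    -- Write n y_v as the sum over u of y_v - y_u plus the sum of y. Approximants of a vector in `𝓕`
    -- need not sum to 0, so the last term is kept as an error.
    n∣y∣≤ : ∀ v → ι n ℚ.* ℚ.∣ y v ∣ ℚ.≤ ι (transmission v) ℚ.* g ℚ.+ ℚ.∣ ∑ℚ y ∣
    n∣y∣≤ v = begin
      ι n ℚ.* ℚ.∣ y v ∣                                          ≡⟨ cong (ℚ._* ℚ.∣ y v ∣) (ℚ.0≤p⇒∣p∣≡p (0≤ι n)) ⟨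
      ℚ.∣ ι n ∣ ℚ.* ℚ.∣ y v ∣                                    ≡⟨ ℚ.∣p*q∣≡∣p∣*∣q∣ (ι n) (y v) ⟨
      ℚ.∣ ι n ℚ.* y v ∣                                          ≡⟨ cong ℚ.∣_∣ (∑ℚ-const n (y v)) ⟨
      ℚ.∣ ∑ℚ {n} (λ _ → y v) ∣                                   ≡⟨ cong ℚ.∣_∣ (ℚ∑.sum-cong-≗ (λ u → p≡p-q+q (y v) (y u))) ⟩
      ℚ.∣ ∑ℚ (λ u → (y v ℚ.- y u) ℚ.+ y u) ∣                     ≡⟨ cong ℚ.∣_∣ (ℚ∑.∑-distrib-+ (λ u → y v ℚ.- y u) y) ⟩
      ℚ.∣ ∑ℚ (λ u → y v ℚ.- y u) ℚ.+ ∑ℚ y ∣                      ≤⟨ ℚ.∣p+q∣≤∣p∣+∣q∣ (∑ℚ (λ u → y v ℚ.- y u)) (∑ℚ y) ⟩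
      ℚ.∣ ∑ℚ (λ u → y v ℚ.- y u) ∣ ℚ.+ ℚ.∣ ∑ℚ y ∣                ≤⟨ ℚ.+-monoˡ-≤ ℚ.∣ ∑ℚ y ∣ (ℚ.≤-trans (∣∑ℚ∣≤∑ℚ∣∣ (λ u → y v ℚ.- y u)) (∑ℚ-mono-≤ deviation)) ⟩
      ∑ℚ (λ u → ι (d u v) ℚ.* g) ℚ.+ ℚ.∣ ∑ℚ y ∣                  ≡⟨ cong (ℚ._+ ℚ.∣ ∑ℚ y ∣) (ℚ∑.*-distribʳ-sum g (λ u → ι (d u v))) ⟨
      ∑ℚ (λ u → ι (d u v)) ℚ.* g ℚ.+ ℚ.∣ ∑ℚ y ∣                  ≡⟨ cong (λ s → s ℚ.* g ℚ.+ ℚ.∣ ∑ℚ y ∣) (∑ℚ-ι (λ u → d u v)) ⟩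
      ι (transmission v) ℚ.* g ℚ.+ ℚ.∣ ∑ℚ y ∣                    ∎
      where
      deviation : ∀ u → ℚ.∣ y v ℚ.- y u ∣ ℚ.≤ ι (d u v) ℚ.* g
      deviation u = ℚ.≤-trans (ℚ.≤-reflexive (∣p-q∣≡∣q-p∣ (y v) (y u))) (walk-lipschitz (geodesic u v))

  module _ {D} (≤D : ∀ v → transmission v ℕ.≤ D) (x : Vector ℝ n) (i : ℕ) where

    n‖x‖≤ : ι n ℚ.* seq ‖ x ‖∞ i ℚ.≤ ι D ℚ.* seq (γₓ G x) i ℚ.+ ℚ.∣ seq (∑ x) i ∣
    n‖x‖≤ = seq-⨆-elim i (λ p → ι n ℚ.* p ℚ.≤ bound) (λ v → ∣ x v ∣)
      -- The maximum starts from 0, so the bound must also be shown to be nonnegative.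
      (ℚ.≤-trans (ℚ.≤-reflexive (ℚ.*-zeroʳ (ι n))) 0≤bound)
      λ v → ℚ.≤-trans (ℚ.≤-reflexive (cong (ι n ℚ.*_) (p⊔-p≡∣p∣ (y v))))
              (ℚ.≤-trans (n∣y∣≤ y (seq-γₓ-upper i G x) v) (transmission≤bound v))
      where
      y : Vector ℚ n
      y v = seq (x v) i

      g bound : ℚ
      g     = seq (γₓ G x) i
      bound = ι D ℚ.* g ℚ.+ ℚ.∣ seq (∑ x) i ∣

      instance
        g-nonNeg : ℚ.NonNegative g
        g-nonNeg = ℚ.nonNegative (0≤seq-⨆ i (λ u → ⨆ λ v → if does (adj? G u v) then ∣ x u - x v ∣ else 0ℝ))

      0≤bound : 0ℚ ℚ.≤ bound
      0≤bound = ℚ.+-mono-≤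
        (subst (ℚ._≤ ι D ℚ.* g) (ℚ.*-zeroˡ g) (ℚ.*-monoʳ-≤-nonNeg g (0≤ι D)))
        (ℚ.0≤∣p∣ (seq (∑ x) i))

      transmission≤bound : ∀ v → ι (transmission v) ℚ.* g ℚ.+ ℚ.∣ ∑ℚ y ∣ ℚ.≤ bound
      transmission≤bound v = ℚ.+-mono-≤ (ℚ.*-monoʳ-≤-nonNeg g (ι-mono-≤ (≤D v)))
        (ℚ.≤-reflexive (cong ℚ.∣_∣ (sym (seq-∑ i x))))

  -- The value n / D is carried as a variable `r` with an equation, which keeps normalised fractions
  -- out of the arithmetic.
  module _ (c : Fin n) (farthest : ∀ v → transmission v ℕ.≤ transmission c)
           .{{_ : NonZero (transmission c)}} {r : ℚ} (r≡n/D : r ≡ + n / transmission c) where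

    private
      D : ℕ
      D = transmission c

      rD≡n : r ℚ.* ι D ≡ ι n
      rD≡n = trans (cong (ℚ._* ι D) r≡n/D) (/-cancel n D)

      instance
        ιn-nonNeg : ℚ.NonNegative (ι n)
        ιn-nonNeg = ι-nonNeg n

        ιD-nonNeg : ℚ.NonNegative (ι D)
        ιD-nonNeg = ι-nonNeg D

      0≤r : 0ℚ ℚ.≤ r
      0≤r = subst (0ℚ ℚ.≤_) (sym r≡n/D) (/-≤ 0 1 n D z≤n)

      instance
        r-nonNeg : ℚ.NonNegative r
        r-nonNeg = ℚ.nonNegative 0≤r

      1≤ιD : 1ℚ ℚ.≤ ι D
      1≤ιD = subst (ℚ._≤ ι D) ι-1 (ι-mono-≤ (ℕ.>-nonZero⁻¹ D))

    module _ (ε : ℚ) (0<ε : 0ℚ ℚ.< ε) where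

      opaque

        -- The tolerance for both constraints of `𝓕`: the norm error enters with weight n and the
        -- sum error with weight 1, giving (n + 1) δ = ε in total.
        δ : ℚ
        δ = ε ℚ.* (+ 1 / suc n)

        0<δ : 0ℚ ℚ.< δ
        0<δ = subst (ℚ._< δ) (ℚ.*-zeroˡ (+ 1 / suc n))
          (ℚ.*-monoˡ-<-pos (+ 1 / suc n) {{ℚ.normalize-pos 1 (suc n)}} 0<ε)

        δ[n+1]≡ε : δ ℚ.* ι (suc n) ≡ ε
        δ[n+1]≡ε = begin
          ε ℚ.* (+ 1 / suc n) ℚ.* ι (suc n)         ≡⟨ ℚ.*-assoc ε (+ 1 / suc n) (ι (suc n)) ⟩
          ε ℚ.* (+ 1 / suc n ℚ.* ι (suc n))         ≡⟨ cong (ε ℚ.*_) (trans (/-cancel 1 (suc n)) ι-1) ⟩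
          ε ℚ.* 1ℚ                                  ≡⟨ ℚ.*-identityʳ ε ⟩
          ε                                         ∎
          where open ≡-Reasoning

      nδ+δ≡ε : ι n ℚ.* δ ℚ.+ δ ≡ ε
      nδ+δ≡ε = trans (identity (ι n) δ) (trans (cong (δ ℚ.*_) (sym (ι-suc n))) δ[n+1]≡ε)
        where
        open +-*-Solver
        identity : ∀ a t → a ℚ.* t ℚ.+ t ≡ t ℚ.* (1ℚ ℚ.+ a)
        identity = solve 2 (λ a t → a :* t :+ t := t :* (con 1ℚ :+ a)) refl

      -- After multiplication by D the gap is n - D g = n (1 - ‖x‖) + (n ‖x‖ - D g), where the first
      -- summand is at most n δ and the second is below δ.
      γ-lower-at : ∀ x i → ℚ.∣ seq (∑ x) i ℚ.- 0ℚ ∣ ℚ.< δ → ℚ.∣ seq ‖ x ‖∞ i ℚ.- 1ℚ ∣ ℚ.< δ →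
                   r ℚ.- seq (γₓ G x) i ℚ.< ε
      γ-lower-at x i S<δ N-1<δ = ℚ.*-cancelʳ-<-nonNeg (ι D) (begin-strict
        (r ℚ.- g) ℚ.* ι D                             ≡⟨ identity₁ r g (ι D) ⟩
        r ℚ.* ι D ℚ.- ι D ℚ.* g                       ≡⟨ cong (ℚ._- ι D ℚ.* g) rD≡n ⟩
        ι n ℚ.- ι D ℚ.* g                             ≡⟨ identity₂ (ι n) ‖x‖ (ι D ℚ.* g) ⟩
        ι n ℚ.* (1ℚ ℚ.- ‖x‖) ℚ.+ (ι n ℚ.* ‖x‖ ℚ.- ι D ℚ.* g)
          ≤⟨ ℚ.+-mono-≤ (ℚ.*-monoˡ-≤-nonNeg (ι n) (ℚ.<⇒≤ 1-‖x‖<δ)) (ℚ.+-monoˡ-≤ (ℚ.- (ι D ℚ.* g)) (n‖x‖≤ farthest x i)) ⟩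
        ι n ℚ.* δ ℚ.+ (ι D ℚ.* g ℚ.+ S ℚ.- ι D ℚ.* g) ≡⟨ cong (ι n ℚ.* δ ℚ.+_) (identity₃ (ι D ℚ.* g) S) ⟩
        ι n ℚ.* δ ℚ.+ S                               <⟨ ℚ.+-monoʳ-< (ι n ℚ.* δ) (subst (λ p → ℚ.∣ p ∣ ℚ.< δ) (ℚ.+-identityʳ (seq (∑ x) i)) S<δ) ⟩
        ι n ℚ.* δ ℚ.+ δ                               ≡⟨ nδ+δ≡ε ⟩
        ε                                             ≡⟨ ℚ.*-identityʳ ε ⟨
        -- Since D is at least 1, the bound ε also suffices for the gap scaled by D.
        ε ℚ.* 1ℚ                                      ≤⟨ ℚ.*-monoˡ-≤-nonNeg ε {{ℚ.nonNegative (ℚ.<⇒≤ 0<ε)}} 1≤ιD ⟩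
        ε ℚ.* ι D                                     ∎)
        where
        open ℚ.≤-Reasoning
        g ‖x‖ S : ℚ
        g   = seq (γₓ G x) i
        ‖x‖ = seq ‖ x ‖∞ i
        S   = ℚ.∣ seq (∑ x) i ∣

        1-‖x‖<δ : 1ℚ ℚ.- ‖x‖ ℚ.< δ
        1-‖x‖<δ = ℚ.≤-<-trans (p≤∣p∣ _) (subst (ℚ._< δ) (∣p-q∣≡∣q-p∣ ‖x‖ 1ℚ) N-1<δ)

        open +-*-Solver
        identity₁ : ∀ r g D → (r ℚ.- g) ℚ.* D ≡ r ℚ.* D ℚ.- D ℚ.* g
        identity₁ = solve 3 (λ r g D → (r :- g) :* D := r :* D :- D :* g) refl
        identity₂ : ∀ n x t → n ℚ.- t ≡ n ℚ.* (1ℚ ℚ.- x) ℚ.+ (n ℚ.* x ℚ.- t)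
        identity₂ = solve 3 (λ n x t → n :- t := n :* (con 1ℚ :- x) :+ (n :* x :- t)) refl
        identity₃ : ∀ t s → t ℚ.+ s ℚ.- t ≡ s
        identity₃ = solve 2 (λ t s → t :+ s :- t := s) refl

    γ-lower : ∀ x → 𝓕 n x → fromℚ r ≤ γₓ G x
    γ-lower x (∑≃0 , ‖‖≃1) ε 0<ε =
      let M , ∑-close  = ∑≃0 (δ ε 0<ε) (0<δ ε 0<ε)
          N , ‖‖-close = ‖‖≃1 (δ ε 0<ε) (0<δ ε 0<ε)
      in M ℕ.⊔ N , λ i le → γ-lower-at ε 0<ε x i
           (∑-close i (ℕ.m⊔n≤o⇒m≤o M N le)) (‖‖-close i (ℕ.m⊔n≤o⇒n≤o M N le))

    private
      z : Vector ℚ n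
      z u = 1ℚ ℚ.- r ℚ.* ι (d u c)

      0≤rd : ∀ u → 0ℚ ℚ.≤ r ℚ.* ι (d u c)
      0≤rd u = subst (ℚ._≤ r ℚ.* ι (d u c)) (ℚ.*-zeroʳ r) (ℚ.*-monoˡ-≤-nonNeg r (0≤ι (d u c)))

      ι-2 : ι 2 ≡ 1ℚ ℚ.+ 1ℚ
      ι-2 = trans (ι-suc 1) (cong (1ℚ ℚ.+_) ι-1)

      rd≤2 : ∀ u → r ℚ.* ι (d u c) ℚ.≤ ι 2
      rd≤2 u = subst (ℚ._≤ ι 2) (sym (trans (cong (ℚ._* ι (d u c)) r≡n/D) (/-*ι n D (d u c)))) (/-≤ι (n ℕ.* d u c) D 2 (begin
        n ℕ.* d u c                          ≤⟨ n*d≤transmissions u c ⟩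
        transmission u ℕ.+ D                 ≤⟨ ℕ.+-monoˡ-≤ D (farthest u) ⟩
        D ℕ.+ D                              ≡⟨ cong (D ℕ.+_) (ℕ.+-identityʳ D) ⟨
        2 ℕ.* D                              ∎))
        where open ℕ.≤-Reasoning

      z≤1 : ∀ u → z u ℚ.≤ 1ℚ
      z≤1 u = ℚ.≤-trans (ℚ.+-monoʳ-≤ 1ℚ (ℚ.neg-antimono-≤ (0≤rd u))) (ℚ.≤-reflexive (ℚ.+-identityʳ 1ℚ))

      -z≤1 : ∀ u → ℚ.- z u ℚ.≤ 1ℚ
      -- The bound obtained is the negative of 1 - (1 + 1), which evaluates to `1ℚ`.
      -z≤1 u = ℚ.neg-antimono-≤ (ℚ.+-monoʳ-≤ 1ℚ (ℚ.neg-antimono-≤ (ℚ.≤-trans (rd≤2 u) (ℚ.≤-reflexive ι-2))))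

      zc≡1 : z c ≡ 1ℚ
      zc≡1 = cong (λ t → 1ℚ ℚ.- t) (trans (cong (λ k → r ℚ.* k) (trans (cong ι (d-refl c)) ι-0)) (ℚ.*-zeroʳ r))

      -- The subtracted terms sum to r D = n, which cancels the n ones.
      ∑z≡0 : ∑ℚ z ≡ 0ℚ
      ∑z≡0 = begin
        ∑ℚ z                                      ≡⟨ identity (∑ℚ z) (ι n) ⟩
        (∑ℚ z ℚ.+ ι n) ℚ.- ι n                    ≡⟨ cong (λ p → (∑ℚ z ℚ.+ p) ℚ.- ι n) ∑rd≡n ⟨
        (∑ℚ z ℚ.+ ∑ℚ rd) ℚ.- ι n                  ≡⟨ cong (ℚ._- ι n) (ℚ∑.∑-distrib-+ z rd) ⟨
        ∑ℚ (λ u → z u ℚ.+ rd u) ℚ.- ι n           ≡⟨ cong (ℚ._- ι n) (ℚ∑.sum-cong-≗ (λ u → sym (p≡p-q+q 1ℚ (rd u)))) ⟩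
        ∑ℚ {n} (λ _ → 1ℚ) ℚ.- ι n                 ≡⟨ cong (ℚ._- ι n) (trans (∑ℚ-const n 1ℚ) (ℚ.*-identityʳ (ι n))) ⟩
        ι n ℚ.- ι n                               ≡⟨ ℚ.+-inverseʳ (ι n) ⟩
        0ℚ                                        ∎
        where
        open ≡-Reasoning
        rd : Vector ℚ n
        rd u = r ℚ.* ι (d u c)

        ∑rd≡n : ∑ℚ rd ≡ ι n
        ∑rd≡n = trans (sym (ℚ∑.*-distribˡ-sum r (λ u → ι (d u c))))
          (trans (cong (r ℚ.*_) (∑ℚ-ι (λ u → d u c))) rD≡n)

        open +-*-Solver
        identity : ∀ p q → p ≡ (p ℚ.+ q) ℚ.- q
        identity = solve 2 (λ p q → p := (p :+ q) :- q) refl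

      -- Distances to `c` differ by at most one along an edge, and `z` scales distance by `r`.
      z-step : ∀ u v → Adj G u v → z u ℚ.- z v ℚ.≤ r
      z-step u v a = begin
        z u ℚ.- z v                                                ≡⟨ identity (r ℚ.* ι (d u c)) (r ℚ.* ι (d v c)) ⟩
        r ℚ.* ι (d v c) ℚ.- r ℚ.* ι (d u c)                        ≤⟨ ℚ.+-monoˡ-≤ _ (ℚ.*-monoˡ-≤-nonNeg r (ι-mono-≤ (d-adj c (symm G a)))) ⟩
        r ℚ.* ι (suc (d u c)) ℚ.- r ℚ.* ι (d u c)                  ≡⟨ cong (λ p → r ℚ.* p ℚ.- r ℚ.* ι (d u c)) (ι-suc (d u c)) ⟩
        r ℚ.* (1ℚ ℚ.+ ι (d u c)) ℚ.- r ℚ.* ι (d u c)               ≡⟨ identity′ r (ι (d u c)) ⟩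
        r                                                          ∎
        where
        open ℚ.≤-Reasoning
        open +-*-Solver
        identity : ∀ p q → (1ℚ ℚ.- p) ℚ.- (1ℚ ℚ.- q) ≡ q ℚ.- p
        identity = solve 2 (λ p q → (con 1ℚ :- p) :- (con 1ℚ :- q) := q :- p) refl
        identity′ : ∀ r p → r ℚ.* (1ℚ ℚ.+ p) ℚ.- r ℚ.* p ≡ r
        identity′ = solve 2 (λ r p → r :* (con 1ℚ :+ p) :- r :* p := r) refl

      ∣z-step∣ : ∀ u v → Adj G u v → ℚ.∣ z u ℚ.- z v ∣ ℚ.≤ r
      ∣z-step∣ u v a with ℚ.∣p∣≡p∨∣p∣≡-p (z u ℚ.- z v)
      ... | inj₁ e = ℚ.≤-trans (ℚ.≤-reflexive e) (z-step u v a)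
      ... | inj₂ e = ℚ.≤-trans (ℚ.≤-reflexive (trans e (-[p-q]≡q-p (z u) (z v)))) (z-step v u (symm G a))

    optimum : Vector ℝ n
    optimum u = fromℚ (z u)

    private
      seq-∑-optimum : ∀ i → seq (∑ optimum) i ≡ 0ℚ
      seq-∑-optimum i = trans (seq-∑ i optimum) ∑z≡0

      seq-‖optimum‖ : ∀ i → seq ‖ optimum ‖∞ i ≡ 1ℚ
      seq-‖optimum‖ i = ℚ.≤-antisym
        (seq-⨆-elim i (ℚ._≤ 1ℚ) (λ u → ∣ optimum u ∣) (ℚ.nonNegative⁻¹ 1ℚ) (λ u → ℚ.⊔-lub (z≤1 u) (-z≤1 u)))
        -- The norm 1 is attained at `c`, whose distance to itself is 0.
        (ℚ.≤-trans (ℚ.≤-reflexive (sym zc≡1))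
          (ℚ.≤-trans (ℚ.p≤p⊔q (z c) (ℚ.- z c)) (seq-⨆-upper i (λ u → ∣ optimum u ∣) c)))

      -- No edge attaining `r` has to be exhibited: the general inequality `n‖x‖≤`, with norm 1 and
      -- sum 0, already forces the largest jump up to n / D.
      seq-γ-optimum : ∀ i → seq (γₓ G optimum) i ≡ r
      seq-γ-optimum i = ℚ.≤-antisym (seq-γₓ-least i G optimum 0≤r ∣z-step∣)
        (ℚ.*-cancelˡ-≤-pos (ι D) {{ℚ.positive (ℚ.<-≤-trans (ℚ.positive⁻¹ 1ℚ) 1≤ιD)}} (begin
          ι D ℚ.* r                                             ≡⟨ ℚ.*-comm (ι D) r ⟩
          r ℚ.* ι D                                             ≡⟨ rD≡n ⟩
          ι n                                                   ≡⟨ ℚ.*-identityʳ (ι n) ⟨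
          ι n ℚ.* 1ℚ                                            ≡⟨ cong (ι n ℚ.*_) (seq-‖optimum‖ i) ⟨
          ι n ℚ.* seq ‖ optimum ‖∞ i                            ≤⟨ n‖x‖≤ farthest optimum i ⟩
          ι D ℚ.* γ′ ℚ.+ ℚ.∣ seq (∑ optimum) i ∣                ≡⟨ cong (λ p → ι D ℚ.* γ′ ℚ.+ ℚ.∣ p ∣) (seq-∑-optimum i) ⟩
          ι D ℚ.* γ′ ℚ.+ 0ℚ                                     ≡⟨ ℚ.+-identityʳ _ ⟩
          ι D ℚ.* γ′                                            ∎))
        where
        open ℚ.≤-Reasoning
        γ′ : ℚ
        γ′ = seq (γₓ G optimum) i

    isGamma-n/D : IsGamma G (fromℚ r)
    isGamma-n/D =
      ( optimum
      , (≗⇒≃ (∑ optimum) 0ℝ seq-∑-optimum , ≗⇒≃ ‖ optimum ‖∞ 1ℝ seq-‖optimum‖)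
      , ≗⇒≃ (γₓ G optimum) (fromℚ r) seq-γ-optimum
      ) , γ-lower

-- The bounds on γ and their equality cases.

module _ {n} .{{_ : NonZero n}} (G : Graph (suc n)) (conn : Connected G) (c : Fin (suc n))
         (farthest : ∀ v → Distance.transmission G conn v ℕ.≤ Distance.transmission G conn c)
         .{{_ : NonZero (Distance.transmission G conn c)}} where

  open Distance G conn

  private
    D : ℕ
    D = transmission c

    complete⇒n≡D : G ≅ complete (suc n) → n ≡ D
    complete⇒n≡D iso = ℕ.≤-antisym (n≤transmission G conn c) (complete⇒transmission≤ G conn iso c)

  -- Here n is one less than the number of vertices and γ = (n + 1) / D. Cross-multiplication turns
  -- the two bounds into 2 D ≤ (n + 1) n and n ≤ D, and equality in them into the two extremal cases
  -- for D.
  gamma-bounds-and-equality :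
    ∃ λ (γ : ℝ) → IsGamma G γ ×
    (fromℚ (+ 2 / n) ≤ γ × γ ≤ fromℚ (+ suc n / n)) ×
    (γ ≃ fromℚ (+ 2 / n) ⇔ G ≅ path (suc n)) ×
    (γ ≃ fromℚ (+ suc n / n) ⇔ G ≅ complete (suc n))
  gamma-bounds-and-equality =
    fromℚ (+ suc n / D) , isGamma-n/D G conn c farthest refl ,
    ( fromℚ-mono-≤ (/-≤ 2 n (suc n) D (2transmission≤ c))
    , fromℚ-mono-≤ (/-≤ (suc n) D (suc n) n (ℕ.*-monoʳ-≤ (suc n) (n≤transmission G conn c)))) ,
    mk⇔ (λ γ≃ → extremal⇒path G conn c (sym (/-≡⁻¹ (suc n) D 2 n (fromℚ-injective {γ} {+ 2 / n} γ≃))))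
        (λ iso → fromℚ-cong {γ} {+ 2 / n} (/-≡ (suc n) D 2 n (sym (path⇒extremal G conn iso c farthest)))) ,
    mk⇔ (λ γ≃ → transmission≤⇒complete G conn λ v → ℕ.≤-trans (farthest v) (ℕ.≤-reflexive
          (sym (ℕ.*-cancelˡ-≡ n D (suc n)
            (/-≡⁻¹ (suc n) D (suc n) n (fromℚ-injective {γ} {+ suc n / n} γ≃))))))
        (λ iso → fromℚ-cong {γ} {+ suc n / n} (/-≡ (suc n) D (suc n) n (cong (suc n ℕ.*_) (complete⇒n≡D iso))))
    where
    γ : ℚ
    γ = + suc n / D

theorem4p7 : ∀ (n : ℕ) .{{_ : NonTrivial n}} (G : Graph n) → Connected G →
    ∃ λ (γ : ℝ) → IsGamma G γ ×
    (fromℚ (+ 2 / (n ∸ 1)) ≤ γ × γ ≤ fromℚ (+ n / (n ∸ 1))) ×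
    (γ ≃ fromℚ (+ 2 / (n ∸ 1)) ⇔ G ≅ path n) ×
    (γ ≃ fromℚ (+ n / (n ∸ 1)) ⇔ G ≅ complete n)
theorem4p7 (suc (suc _)) G conn =
  let c , farthest = argmax (Distance.transmission G conn) in
  -- D is nonzero because it is at least the number of vertices minus one, which is positive here.
  gamma-bounds-and-equality G conn c farthest {{ℕ.>-nonZero (ℕ.≤-trans (s≤s z≤n) (n≤transmission G conn c))}}
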